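{- Let $X\in\{0,1\}^{m\times n}$ and let $Q\subseteq\operatorname{supp}(X)$ be nonempty. If the generalised binary matrix $X^Q$ is minimally non-firm and $X^P$ is firm for every $P\subsetneq Q$, then the binary matrix $\mathcal{S}^Q(X)\in\{0,1\}^{(m+|Q|)\times(n+|Q|)}$ is minimally non-firm.
   Context: A generalised binary matrix is a matrix $Y=(y_{i,j})$ with entries in $\{0,1,?\}$ (binary matrices are a special case); $\operatorname{supp}(Y)=\{(i,j):y_{i,j}=1\}$. A submatrix indexed by $I\times J$ is obtained by deleting rows not in $I$ and columns not in $J$; it is proper if not all rows and columns are kept. A rectangle of $Y$ is a submatrix $I\times J$ containing no entry $0$. $br(Y)$ is the minimum number of rectangles whose union contains $\operatorname{supp}(Y)$ (entries $?$ need not be covered). An isolated set is a subset of $\operatorname{supp}(Y)$ no two elements of which lie in a common rectangle of $Y$; $i(Y)$ is the maximum size of an isolated set. $Y$ is firm if $i(Y')=br(Y')$ for every submatrix $Y'$ of $Y$ (including $Y$); $Y$ is minimally non-firm if $i(Y)<br(Y)$ and $i(Y')=br(Y')$ for every proper submatrix $Y'$. For $X\in\{0,1\}^{m\times n}$ and $P\subseteq\operatorname{supp}(X)$, $X^P$ is the generalised binary matrix obtained from $X$ by replacing each entry at a position in $P$ by $?$. Stretching: for nonempty $Q\subseteq\operatorname{supp}(X)$, list $Q=\{q_1,\dots,q_t\}$ with $q_s=(\ell_s,k_s)$ in non-decreasing order of row index and then column index. $\mathcal{S}^Q(X)$ is the $(m+t)\times(n+t)$ binary matrix whose top-left $m\times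 n$ block is $X$, which for each $s\in[t]$ has entries equal to $1$ at $(\ell_s,n+s)$, $(m+s,k_s)$ and $(m+s,n+s)$, and whose other entries are $0$. -}

module Defs where

open import Data.Nat using (ℕ; _<_)
open import Data.Bool using (Bool; true; false; if_then_else_)
open import Data.Fin using (Fin; splitAt; _≟_)
open import Data.Fin.Subset using (Subset; _∈_; _⊆_; ⊤)
open import Data.List using (List; []; _∷_; concatMap; length; lookup; filter)
open import Data.List.Base using (map)
open import Data.Fin.Base using ()
open import Data.List using (allFin)
open import Data.Product using (Σ; ∃; _×_; _,_; proj₁; proj₂)
open import Data.Sum using (_⊎_; inj₁; inj₂)
open import Relation.Binary.PropositionalEquality using (_≡_; _≢_)
open import Relation.Nullary using (¬_; does)
open import Relation.Nullary.Decidable using (⌊_⌋)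
open import Data.Bool.Properties using (_≟_)
open import Function.Definitions using (Injective)

data Entry : Set where
  𝟎 𝟏 ⁇ : Entry

GMatrix : ℕ → ℕ → Set
GMatrix m n = Fin m → Fin n → Entry

BMatrix : ℕ → ℕ → Set
BMatrix m n = Fin m → Fin n → Bool

PosSet : ℕ → ℕ → Set
PosSet m n = Fin m → Fin n → Bool

toG : ∀ {m n} → BMatrix m n → GMatrix m n
toG X i j = if X i j then 𝟏 else 𝟎

_^^_ : ∀ {m n} → BMatrix m n → PosSet m n → GMatrix m n
(X ^^ P) i j = if P i j then ⁇ else toG X i j

_⊆supp_ : ∀ {m n} → PosSet m n → BMatrix m n → Set
P ⊆supp X = ∀ i j → P i j ≡ true → X i j ≡ true

_⊆P_ : ∀ {m n} → PosSet m n → PosSet m n → Set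
P ⊆P Q = ∀ i j → P i j ≡ true → Q i j ≡ true

_⊊P_ : ∀ {m n} → PosSet m n → PosSet m n → Set
P ⊊P Q = P ⊆P Q × ∃ λ i → ∃ λ j → Q i j ≡ true × P i j ≡ false

NonEmptyP : ∀ {m n} → PosSet m n → Set
NonEmptyP Q = ∃ λ i → ∃ λ j → Q i j ≡ true

-- Submatrices are indexed by I × J (row subset, column subset).
-- All notions below are relative to the submatrix I × J of Y.

module _ {m n : ℕ} (Y : GMatrix m n) (I : Subset m) (J : Subset n) where

  IsRect : Subset m × Subset n → Set
  IsRect (A , B) = A ⊆ I × B ⊆ J × (∀ a b → a ∈ A → b ∈ B → Y a b ≢ 𝟎)

  InSupp : Fin m × Fin n → Set
  InSupp (i , j) = i ∈ I × j ∈ J × Y i j ≡ 𝟏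

  Cover : ℕ → Set
  Cover k = Σ (Fin k → Subset m × Subset n) λ R →
              (∀ s → IsRect (R s)) ×
              (∀ p → InSupp p → ∃ λ s → proj₁ p ∈ proj₁ (R s) × proj₂ p ∈ proj₂ (R s))

  Isolated : ℕ → Set
  Isolated k = Σ (Fin k → Fin m × Fin n) λ f →
                 Injective _≡_ _≡_ f ×
                 (∀ s → InSupp (f s)) ×
                 (∀ s s' → s ≢ s' → ∀ R → IsRect R →
                    ¬ ((proj₁ (f s) ∈ proj₁ R × proj₂ (f s) ∈ proj₂ R) ×
                       (proj₁ (f s') ∈ proj₁ R × proj₂ (f s') ∈ proj₂ R)))

  BrIs : ℕ → Set
  BrIs k = Cover k × (∀ k' → Cover k' → k Data.Nat.≤ k')

  IIs : ℕ → Set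
  IIs k = Isolated k × (∀ k' → Isolated k' → k' Data.Nat.≤ k)

IEqBr : ∀ {m n} → GMatrix m n → Subset m → Subset n → Set
IEqBr Y I J = ∀ a b → IIs Y I J a → BrIs Y I J b → a ≡ b

ILtBr : ∀ {m n} → GMatrix m n → Subset m → Subset n → Set
ILtBr Y I J = ∀ a b → IIs Y I J a → BrIs Y I J b → a < b

Firm : ∀ {m n} → GMatrix m n → Set
Firm {m} {n} Y = ∀ (I : Subset m) (J : Subset n) → IEqBr Y I J

MinimallyNonFirm : ∀ {m n} → GMatrix m n → Set
MinimallyNonFirm {m} {n} Y =
  ILtBr Y ⊤ ⊤ ×
  (∀ (I : Subset m) (J : Subset n) → ¬ (I ≡ ⊤ × J ≡ ⊤) → IEqBr Y I J)

enum : ∀ {m n} → PosSet m n → List (Fin m × Fin n)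
enum {m} {n} Q = concatMap (λ i → map (λ j → (i , j)) (filter (λ j → Q i j Data.Bool.Properties.≟ true) (allFin n))) (allFin m)

card : ∀ {m n} → PosSet m n → ℕ
card Q = length (enum Q)

stretch : ∀ {m n} → BMatrix m n → (Q : PosSet m n) →
          BMatrix (m Data.Nat.+ card Q) (n Data.Nat.+ card Q)
stretch {m} {n} X Q r c with splitAt m r | splitAt n c
... | inj₁ i | inj₁ j = X i j
... | inj₁ i | inj₂ s = ⌊ i Data.Fin.≟ proj₁ (lookup (enum Q) s) ⌋
... | inj₂ s | inj₁ j = ⌊ j Data.Fin.≟ proj₂ (lookup (enum Q) s) ⌋
... | inj₂ s | inj₂ s' = ⌊ s Data.Fin.≟ s' ⌋

{-# OPTIONS --safe #-}
module Submission where

-- A rectangle containing the corner (m+s, n+s) lies in the 2×2 block spanned by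
-- that corner and q_s, so any cover of the stretched matrix spends |Q| rectangles
-- that meet X only inside Q, while an isolated set has at most one element in each
-- block. Passing from X^Q to its stretching thus raises br by at least |Q| and i by
-- at most |Q|. In a proper submatrix, a pair (row m+s, column n+s) kept entirely
-- adds exactly one to both i and br and turns q_s into ?; a new row kept without its
-- column has a single 1, so it adds one for column k_s and deletes that column, and
-- dually. What remains is a submatrix of X^P, where P consists of the q_s whose pair
-- is kept: it is covered by firmness if P ≠ Q, and by minimality of X^Q if P = Q.
-- Since i and br are attained only up to double negation, the (in)equalities between
-- them are derived from the decidability of the order on ℕ.

open import Defs
open import Data.Nat using (ℕ; zero; suc; _+_; _≤_; _∸_)
import Data.Nat.Properties as ℕ
open import Data.Nat.Induction using (<-rec)
open import Data.Bool using (true; false; if_then_else_)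
import Data.Bool.Properties as Bool
open import Data.Fin using (Fin; zero; suc; splitAt; join; _↑ˡ_; _↑ʳ_; _≟_)
open import Data.Fin.Properties
  using (any?; all?; injective⇒≤; join-splitAt; splitAt-↑ˡ; splitAt-↑ʳ; ¬∀⟶∃¬)
open import Data.Fin.Subset using (Subset; _∈_; ⊤; ⁅_⁆; _∪_; _∩_)
open import Data.Fin.Subset.Properties
  using (_∈?_; ∈⊤; ⊆⊤; ⊆-antisym; x∈⁅x⁆; x∈⁅y⁆⇒x≡y; x∈p∪q⁺; x∈p∪q⁻; x∈p∩q⁺; x∈p∩q⁻; p∩q⊆q)
open import Data.List using (List; []; _∷_; _++_; map; length; lookup; tabulate; filter; allFin)
open import Data.List.Properties using (length-tabulate; length-map)
open import Data.List.Membership.Propositional using (find; lose) renaming (_∈_ to _∈ᴸ_)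
open import Data.List.Membership.Propositional.Properties
  using (∈-lookup; ∈-allFin; ∈-filter⁺; ∈-filter⁻; ∈-map⁺; ∈-map⁻; ∈-concatMap⁺; ∈-concatMap⁻)
open import Data.List.Membership.Setoid.Properties using (index-injective)
open import Data.List.Relation.Unary.All as All using (All; []; _∷_)
import Data.List.Relation.Unary.All.Properties as All
open import Data.List.Relation.Unary.Any as Any using (Any; here; there)
import Data.List.Relation.Unary.Any.Properties as Any
open import Data.List.Relation.Unary.AllPairs as AllPairs using (AllPairs; []; _∷_)
import Data.List.Relation.Unary.AllPairs.Properties as AllPairs
open import Data.List.Relation.Unary.Unique.Propositional using (Unique)
import Data.List.Relation.Unary.Unique.Propositional.Properties as Unique
open import Data.Product using (∃; ∃₂; _×_; _,_; proj₁; proj₂; map₂)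
open import Data.Product.Properties using (,-injectiveʳ)
open import Data.Sum using (_⊎_; inj₁; inj₂; [_,_]′)
import Data.Sum as Sum
import Data.Vec as Vec
open import Data.Vec.Properties using ([]=⇒lookup; lookup⇒[]=; lookup∘tabulate)
open import Function using (_∘_; _on_; case_of_)
open import Relation.Binary.Definitions using (Symmetric)
open import Relation.Binary.PropositionalEquality
open import Relation.Nullary using (¬_; Dec; yes; no; does; contradiction)
open import Relation.Nullary.Decidable
  using (¬?; _×-dec_; dec-true; dec-false; decidable-stable; ⌊_⌋)

-- Subsets and lists given by decidable predicates

does-true : ∀ {A : Set} (a? : Dec A) → does a? ≡ true → A
does-true (yes a) _ = a

⟪_⟫ : ∀ {n} {P : Fin n → Set} → (∀ i → Dec (P i)) → Subset n
⟪ P? ⟫ = Vec.tabulate (does ∘ P?)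

module _ {n : ℕ} {P : Fin n → Set} (P? : ∀ i → Dec (P i)) where

  ∈⟪⟫⁺ : ∀ {i} → P i → i ∈ ⟪ P? ⟫
  ∈⟪⟫⁺ {i} p = lookup⇒[]= i _ (trans (lookup∘tabulate (does ∘ P?) i) (dec-true (P? i) p))

  ∈⟪⟫⁻ : ∀ {i} → i ∈ ⟪ P? ⟫ → P i
  ∈⟪⟫⁻ {i} i∈ = does-true (P? i) (trans (sym (lookup∘tabulate (does ∘ P?) i)) ([]=⇒lookup i∈))

  -- Each index satisfying `P` occurs once, with one chosen proof. Proofs of `P i` need not be
  -- unique, so `collect-complete` and `collect-distinct` compare first components only.
  collect : List (∃ P)
  collect = All.toList (All.all-filter P? (allFin n))

  private
    map-proj₁-toList : ∀ {xs} (pxs : All P xs) → map proj₁ (All.toList pxs) ≡ xs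
    map-proj₁-toList []         = refl
    map-proj₁-toList (px ∷ pxs) = cong (_ ∷_) (map-proj₁-toList pxs)

    map-proj₁-collect : map proj₁ collect ≡ filter P? (allFin n)
    map-proj₁-collect = map-proj₁-toList (All.all-filter P? (allFin n))

  collect-complete : ∀ {i} → P i → Any ((i ≡_) ∘ proj₁) collect
  collect-complete {i} p = Any.map⁻ (subst (i ∈ᴸ_) (sym map-proj₁-collect)
    (∈-filter⁺ P? (∈-allFin i) p))

  collect-distinct : AllPairs (_≢_ on proj₁) collect
  collect-distinct = AllPairs.map⁻ (subst Unique (sym map-proj₁-collect)
    (Unique.filter⁺ P? (Unique.allFin⁺ n)))

lookup-pairs : ∀ {A : Set} {R : A → A → Set} → Symmetric R → ∀ {xs} → AllPairs R xs →
               ∀ {i j} → i ≢ j → R (lookup xs i) (lookup xs j)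
lookup-pairs sm (r ∷ rs) {zero}  {zero}  i≢j = contradiction refl i≢j
lookup-pairs sm (r ∷ rs) {zero}  {suc j} i≢j = All.lookup r (∈-lookup j)
-- `AllPairs` relates earlier entries to later ones only; symmetry supplies the reverse order.
lookup-pairs sm (r ∷ rs) {suc i} {zero}  i≢j = sm (All.lookup r (∈-lookup i))
lookup-pairs sm (r ∷ rs) {suc i} {suc j} i≢j = lookup-pairs sm rs (i≢j ∘ cong suc)

unique⇒lookup-injective : ∀ {A : Set} {xs : List A} → Unique xs →
                          ∀ {i j} → lookup xs i ≡ lookup xs j → i ≡ j
unique⇒lookup-injective xs! {i} {j} eq =
  decidable-stable (i ≟ j) (λ i≢j → lookup-pairs ≢-sym xs! i≢j eq)

unique⇒length≤ : ∀ {t} {xs : List (Fin t)} → Unique xs → length xs ≤ t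
unique⇒length≤ xs! = injective⇒≤ (unique⇒lookup-injective xs!)

-- Sending each index to a place where it occurs is injective; repetitions in `xs` do no harm.
exhaustive⇒≤length : ∀ {t} {xs : List (Fin t)} → (∀ s → s ∈ᴸ xs) → t ≤ length xs
exhaustive⇒≤length {t} all∈ =
  injective⇒≤ (λ {s} {s'} → index-injective (setoid (Fin t)) (all∈ s) (all∈ s'))

-- Sorts a list into two kinds while replacing every entry by a witness of its kind. Recorded as a
-- relation, it lets `All` and `AllPairs` facts pass from `xs` to the witnesses by one induction.
data Split {A B C : Set} (P : A → B → Set) (Q : A → C → Set) : List A → List B → List C → Set where
  []    : Split P Q [] [] []
  left  : ∀ {x b xs bs cs} → P x b → Split P Q xs bs cs → Split P Q (x ∷ xs) (b ∷ bs) cs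
  right : ∀ {x c xs bs cs} → Q x c → Split P Q xs bs cs → Split P Q (x ∷ xs) bs (c ∷ cs)

module _ {A B C : Set} {P : A → B → Set} {Q : A → C → Set} where

  split : ∀ {xs} → All (λ x → ∃ (P x) ⊎ ∃ (Q x)) xs → ∃₂ (Split P Q xs)
  split []                    = _ , _ , []
  split (inj₁ (_ , p) ∷ pqs) = _ , _ , left p (proj₂ (proj₂ (split pqs)))
  split (inj₂ (_ , q) ∷ pqs) = _ , _ , right q (proj₂ (proj₂ (split pqs)))

  split-length : ∀ {xs bs cs} → Split P Q xs bs cs → length xs ≡ length bs + length cs
  split-length []          = refl
  split-length (left _ sp) = cong suc (split-length sp)
  split-length {bs = bs} (right _ sp) =
    trans (cong suc (split-length sp)) (sym (ℕ.+-suc (length bs) _))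

  -- Makes results stated for the left part, such as `split-pairs`, available for the right part.
  split-swap : ∀ {xs bs cs} → Split P Q xs bs cs → Split Q P xs cs bs
  split-swap []           = []
  split-swap (left p sp)  = right p (split-swap sp)
  split-swap (right q sp) = left q (split-swap sp)

  split-complete : ∀ {xs bs cs x} → Split P Q xs bs cs → x ∈ᴸ xs → Any (P x) bs ⊎ Any (Q x) cs
  split-complete (left p sp)  (here refl) = inj₁ (here p)
  split-complete (right q sp) (here refl) = inj₂ (here q)
  split-complete (left p sp)  (there x∈)  = Sum.map₁ there (split-complete sp x∈)
  split-complete (right q sp) (there x∈)  = Sum.map₂ there (split-complete sp x∈)

  split-all : ∀ {xs bs cs} {T : A → Set} {U : B → Set} → (∀ {x b} → T x → P x b → U b) →
              Split P Q xs bs cs → All T xs → All U bs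
  split-all f []           []       = []
  split-all f (left p sp)  (t ∷ ts) = f t p ∷ split-all f sp ts
  split-all f (right q sp) (t ∷ ts) = split-all f sp ts

  split-pairs : ∀ {xs bs cs} {R : A → A → Set} {V : B → B → Set} →
                (∀ {x x' b b'} → R x x' → P x b → P x' b' → V b b') →
                Split P Q xs bs cs → AllPairs R xs → AllPairs V bs
  split-pairs f []           []       = []
  split-pairs f (left p sp)  (r ∷ rs) = split-all (λ r' p' → f r' p p') sp r ∷ split-pairs f sp rs
  split-pairs f (right q sp) (r ∷ rs) = split-pairs f sp rs

-- Extrema up to double negation

¬¬-minimum : ∀ {P : ℕ → Set} {N} → P N → ¬ ¬ ∃ λ k → P k × (∀ k' → P k' → k ≤ k')
-- If there is no minimum, strong induction refutes every `P k`: a `k` below which `P` fails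
-- throughout would be a minimum.
¬¬-minimum {P} pN ¬min = <-rec (¬_ ∘ P)
  (λ k rec pk → ¬min (k , pk , λ k' pk' → ℕ.≮⇒≥ (λ k'<k → rec k'<k pk'))) _ pN

¬¬-maximum : ∀ {P : ℕ → Set} N → P 0 → (∀ k → P k → k ≤ N) →
             ¬ ¬ ∃ λ k → P k × (∀ k' → P k' → k' ≤ k)
¬¬-maximum {P} N p0 bound ¬max =
  -- Maximising `k` means minimising the deficit `d = N - k`; the start `k = 0` has deficit `N`.
  ¬¬-minimum {P = λ d → ∃ λ k → k + d ≡ N × P k} (0 , refl , p0) λ where
    (d , (k , k+d≡N , pk) , dmin) → ¬max (k , pk , λ k' pk' →
      ℕ.+-cancelʳ-≤ d k' k (begin
        k' + d          ≤⟨ ℕ.+-monoʳ-≤ k' (dmin (N ∸ k') (k' , ℕ.m+[n∸m]≡n (bound k' pk') , pk')) ⟩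
        k' + (N ∸ k')   ≡⟨ ℕ.m+[n∸m]≡n (bound k' pk') ⟩
        N               ≡⟨ k+d≡N ⟨
        k + d           ∎))
  where open ℕ.≤-Reasoning

-- Zero-free rectangles and crossing positions

_≟𝟎 : ∀ e → Dec (e ≡ 𝟎)
𝟎 ≟𝟎 = yes refl
𝟏 ≟𝟎 = no λ ()
⁇ ≟𝟎 = no λ ()

𝟏≢𝟎 : ∀ {e} → e ≡ 𝟏 → e ≢ 𝟎
𝟏≢𝟎 refl ()

Rectangle : ℕ → ℕ → Set
Rectangle m n = Subset m × Subset n

_∈ᴿ_ : ∀ {m n} → Fin m × Fin n → Rectangle m n → Set
p ∈ᴿ R = proj₁ p ∈ proj₁ R × proj₂ p ∈ proj₂ R

block : ∀ {m n} → Fin m × Fin n → Fin m × Fin n → Rectangle m n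
block (i , j) (i' , j') = ⁅ i ⁆ ∪ ⁅ i' ⁆ , ⁅ j ⁆ ∪ ⁅ j' ⁆

∈⁅,⁆⁻ : ∀ {n} {x y z : Fin n} → x ∈ ⁅ y ⁆ ∪ ⁅ z ⁆ → x ≡ y ⊎ x ≡ z
∈⁅,⁆⁻ {y = y} {z} x∈ = Sum.map (x∈⁅y⁆⇒x≡y y) (x∈⁅y⁆⇒x≡y z) (x∈p∪q⁻ ⁅ y ⁆ ⁅ z ⁆ x∈)

∈⁅,⁆ˡ : ∀ {n} (y z : Fin n) → y ∈ ⁅ y ⁆ ∪ ⁅ z ⁆
∈⁅,⁆ˡ y z = x∈p∪q⁺ (inj₁ (x∈⁅x⁆ y))

∈⁅,⁆ʳ : ∀ {n} (y z : Fin n) → z ∈ ⁅ y ⁆ ∪ ⁅ z ⁆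
∈⁅,⁆ʳ y z = x∈p∪q⁺ {p = ⁅ y ⁆} (inj₂ (x∈⁅x⁆ z))

module _ {m n : ℕ} (Y : GMatrix m n) where

  ZeroFree : Rectangle m n → Set
  ZeroFree (A , B) = ∀ a b → a ∈ A → b ∈ B → Y a b ≢ 𝟎

  -- Two nonzero positions lie in no common rectangle exactly when one of the
  -- other two corners of the 2×2 submatrix they span is 0.
  Crossing : Fin m × Fin n → Fin m × Fin n → Set
  Crossing (i , j) (i' , j') = Y i j' ≡ 𝟎 ⊎ Y i' j ≡ 𝟎

  crossing-sym : Symmetric Crossing
  crossing-sym = Sum.swap

  crossing-separates : ∀ {p q R} → Crossing p q → ZeroFree R → p ∈ᴿ R → ¬ q ∈ᴿ R
  crossing-separates (inj₁ z) zf (i∈ , j∈) (i'∈ , j'∈) = zf _ _ i∈ j'∈ z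
  crossing-separates (inj₂ z) zf (i∈ , j∈) (i'∈ , j'∈) = zf _ _ i'∈ j∈ z

  block-zeroFree : ∀ {i j i' j'} → Y i j ≢ 𝟎 → Y i j' ≢ 𝟎 → Y i' j ≢ 𝟎 → Y i' j' ≢ 𝟎 →
                   ZeroFree (block (i , j) (i' , j'))
  block-zeroFree w x y z a b a∈ b∈ with ∈⁅,⁆⁻ a∈ | ∈⁅,⁆⁻ b∈
  ... | inj₁ refl | inj₁ refl = w
  ... | inj₁ refl | inj₂ refl = x
  ... | inj₂ refl | inj₁ refl = y
  ... | inj₂ refl | inj₂ refl = z

  rowRect : Fin m → Rectangle m n
  rowRect i = ⁅ i ⁆ , ⟪ (λ j → ¬? (Y i j ≟𝟎)) ⟫

  rowRect-zeroFree : ∀ i → ZeroFree (rowRect i)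
  rowRect-zeroFree i a b a∈ b∈ with refl ← x∈⁅y⁆⇒x≡y i a∈ = ∈⟪⟫⁻ (λ j → ¬? (Y i j ≟𝟎)) b∈

  ∈rowRect : ∀ {i j} → Y i j ≡ 𝟏 → (i , j) ∈ᴿ rowRect i
  ∈rowRect {i} y = x∈⁅x⁆ i , ∈⟪⟫⁺ (λ j → ¬? (Y i j ≟𝟎)) (𝟏≢𝟎 y)

  colRect : Fin n → Rectangle m n
  colRect j = ⟪ (λ i → ¬? (Y i j ≟𝟎)) ⟫ , ⁅ j ⁆

  colRect-zeroFree : ∀ j → ZeroFree (colRect j)
  colRect-zeroFree j a b a∈ b∈ with refl ← x∈⁅y⁆⇒x≡y j b∈ = ∈⟪⟫⁻ (λ i → ¬? (Y i j ≟𝟎)) a∈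

  ∈colRect : ∀ {i j} → Y i j ≡ 𝟏 → (i , j) ∈ᴿ colRect j
  ∈colRect {i} {j} y = ∈⟪⟫⁺ (λ i → ¬? (Y i j ≟𝟎)) (𝟏≢𝟎 y) , x∈⁅x⁆ j

  -- Covers and isolated sets as lists, and weak duality

  module _ (I : Subset m) (J : Subset n) where

    -- The rectangles need not lie inside I × J: they can be cut down to it.
    record IsCover (L : List (Rectangle m n)) : Set where
      constructor _,_
      field
        zeroFree : All ZeroFree L
        covers   : ∀ p → InSupp Y I J p → Any (p ∈ᴿ_) L

    record IsIsolated (F : List (Fin m × Fin n)) : Set where
      constructor _,_
      field
        inSupp   : All (InSupp Y I J) F
        crossing : AllPairs Crossing F

    open IsCover
    open IsIsolated

    cover⇒list : ∀ {k} → Cover Y I J k → ∃ λ L → IsCover L × length L ≡ k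
    cover⇒list (R , rect , cov) = tabulate R
      , (All.tabulate⁺ (λ s → proj₂ (proj₂ (rect s)))
        , (λ p p∈ → Any.tabulate⁺ (proj₁ (cov p p∈)) (proj₂ (cov p p∈))))
      , length-tabulate R

    list⇒cover : ∀ {L} → IsCover L → Cover Y I J (length L)
    list⇒cover {L} c = R , rect , cov
      where
      R : Fin (length L) → Rectangle m n
      R s = proj₁ (lookup L s) ∩ I , proj₂ (lookup L s) ∩ J
      rect : ∀ s → IsRect Y I J (R s)
      rect s = p∩q⊆q A I , p∩q⊆q B J , λ a b a∈ b∈ →
        All.lookup (zeroFree c) (∈-lookup s) a b (proj₁ (x∈p∩q⁻ A I a∈)) (proj₁ (x∈p∩q⁻ B J b∈))
        where
        A = proj₁ (lookup L s)
        B = proj₂ (lookup L s)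
      cov : ∀ p → InSupp Y I J p → ∃ λ s → p ∈ᴿ R s
      cov p p∈@(i∈ , j∈ , _) = Any.index any , x∈p∩q⁺ (proj₁ hit , i∈) , x∈p∩q⁺ (proj₂ hit , j∈)
        where
        any = covers c p p∈
        hit = Any.lookup-index any

    isolated⇒list : ∀ {k} → Isolated Y I J k → ∃ λ F → IsIsolated F × length F ≡ k
    isolated⇒list (f , inj , supp , iso) = tabulate f
      , (All.tabulate⁺ supp , AllPairs.tabulate⁺ cross)
      , length-tabulate f
      where
      cross : ∀ {s s'} → s ≢ s' → Crossing (f s) (f s')
      cross {s} {s'} s≢s' with f s | f s' | supp s | supp s' | iso s s' s≢s'
      ... | i , j | i' , j' | i∈ , j∈ , y | i'∈ , j'∈ , y' | apart
        with Y i j' ≟𝟎 | Y i' j ≟𝟎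
      ... | yes z | _     = inj₁ z
      ... | no _  | yes z = inj₂ z
      -- With both other corners nonzero, the block spanned by the two positions is a rectangle
      -- inside `I` × `J` containing both, against isolation.
      ... | no nz | no nz' = contradiction
        ((∈⁅,⁆ˡ i i' , ∈⁅,⁆ˡ j j') , (∈⁅,⁆ʳ i i' , ∈⁅,⁆ʳ j j'))
        (apart (block (i , j) (i' , j'))
          ( [ (λ { refl → i∈ }) , (λ { refl → i'∈ }) ]′ ∘ ∈⁅,⁆⁻
          , [ (λ { refl → j∈ }) , (λ { refl → j'∈ }) ]′ ∘ ∈⁅,⁆⁻
          , block-zeroFree (𝟏≢𝟎 y) nz nz' (𝟏≢𝟎 y')))

    list⇒isolated : ∀ {F} → IsIsolated F → Isolated Y I J (length F)
    list⇒isolated {F} c = lookup F , inj , supp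
      , λ s s' s≢s' R R-rect → λ (p∈ , q∈) →
          crossing-separates (pair s≢s') (proj₂ (proj₂ R-rect)) p∈ q∈
      where
      supp : ∀ s → InSupp Y I J (lookup F s)
      supp s = All.lookup (inSupp c) (∈-lookup s)
      pair : ∀ {s s'} → s ≢ s' → Crossing (lookup F s) (lookup F s')
      pair = lookup-pairs crossing-sym (crossing c)
      irrefl : ∀ {p} → InSupp Y I J p → ¬ Crossing p p
      irrefl (_ , _ , y) = [ 𝟏≢𝟎 y , 𝟏≢𝟎 y ]′
      inj : ∀ {s s'} → lookup F s ≡ lookup F s' → s ≡ s'
      -- A repeated position would cross itself, which means that its own entry is 0.
      inj {s} {s'} eq = decidable-stable (s ≟ s') λ s≢s' →
        irrefl (supp s) (subst (Crossing (lookup F s)) (sym eq) (pair s≢s'))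

    -- Choose for each isolated element a rectangle covering it: no rectangle is chosen twice.
    isolated≤cover : ∀ {k l} → Isolated Y I J k → Cover Y I J l → k ≤ l
    isolated≤cover (f , inj , supp , iso) (R , rect , cov) =
      injective⇒≤ {f = λ s → proj₁ (cov (f s) (supp s))} λ {s} {s'} eq →
        decidable-stable (s ≟ s') λ s≢s' →
          iso s s' s≢s' _ (rect _)
            ( proj₂ (cov (f s) (supp s))
            , subst (λ r → f s' ∈ᴿ R r) (sym eq) (proj₂ (cov (f s') (supp s'))))

    -- A certificate for equality of `i` and `br`: by weak duality, lists of equal length are both
    -- optimal.
    Tight : Set
    Tight = ∃₂ λ F L → IsIsolated F × IsCover L × length F ≡ length L

    tight⇒IEqBr : Tight → IEqBr Y I J
    tight⇒IEqBr (F , L , iso , cov , eq) a b (isoA , maxA) (covB , minB) =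
      ℕ.≤-antisym (isolated≤cover isoA covB) (begin
        b         ≤⟨ minB _ (list⇒cover cov) ⟩
        length L  ≡⟨ eq ⟨
        length F  ≤⟨ maxA _ (list⇒isolated iso) ⟩
        a         ∎)
      where open ℕ.≤-Reasoning

    -- A crude cover that starts the search for the minimum and bounds the isolated sets.
    rows-cover : IsCover (map rowRect (allFin m))
    rows-cover = All.map⁺ (All.tabulate⁺ rowRect-zeroFree)
               , λ (i , j) (_ , _ , y) → Any.map⁺ (Any.tabulate⁺ i (∈rowRect y))

    ¬¬-BrIs : ¬ ¬ ∃ (BrIs Y I J)
    ¬¬-BrIs = ¬¬-minimum (list⇒cover rows-cover)

    ¬¬-IIs : ¬ ¬ ∃ (IIs Y I J)
    ¬¬-IIs = ¬¬-maximum _ (list⇒isolated ([] , []))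
      (λ k iso → isolated≤cover iso (list⇒cover rows-cover))

    -- `IEqBr` is conditional on optimal values being given; these exist only up to double negation,
    -- and so does the certificate.
    IEqBr⇒¬¬Tight : IEqBr Y I J → ¬ ¬ Tight
    IEqBr⇒¬¬Tight i≡br ¬tight = ¬¬-IIs λ (a , i) → ¬¬-BrIs λ (b , br) →
      let F , iso , |F|≡a = isolated⇒list (proj₁ i)
          L , cov , |L|≡b = cover⇒list (proj₁ br)
      in ¬tight (F , L , iso , cov , trans |F|≡a (trans (i≡br a b i br) (sym |L|≡b)))

-- The enumeration of `Q`

module _ {m n : ℕ} (Q : PosSet m n) where

  private
    row : Fin m → List (Fin m × Fin n)
    row i = map (i ,_) (filter (λ j → Q i j Bool.≟ true) (allFin n))

    ∈-row⁻ : ∀ {i p} → p ∈ᴸ row i → proj₁ p ≡ i × Q (proj₁ p) (proj₂ p) ≡ true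
    ∈-row⁻ {i} p∈ with _ , j∈ , refl ← ∈-map⁻ (i ,_) p∈ =
      refl , proj₂ (∈-filter⁻ (λ j → Q i j Bool.≟ true) {xs = allFin n} j∈)

  ∈-enum⁺ : ∀ {i j} → Q i j ≡ true → (i , j) ∈ᴸ enum Q
  ∈-enum⁺ {i} {j} q = ∈-concatMap⁺ row
    (lose (∈-allFin i) (∈-map⁺ (i ,_) (∈-filter⁺ _ (∈-allFin j) q)))

  ∈-enum⁻ : ∀ {p} → p ∈ᴸ enum Q → Q (proj₁ p) (proj₂ p) ≡ true
  ∈-enum⁻ {p} p∈ = proj₂ (∈-row⁻ (proj₂ (Any.satisfied (∈-concatMap⁻ row {xs = allFin m} p∈))))

  enum-unique : Unique (enum Q)
  enum-unique = Unique.concat⁺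
    (All.map⁺ (All.tabulate⁺ λ i → Unique.map⁺ ,-injectiveʳ (Unique.filter⁺ _ (Unique.allFin⁺ n))))
    (AllPairs.map⁺ (AllPairs.tabulate⁺ λ i≢i' (p∈ , p∈') →
      i≢i' (trans (sym (proj₁ (∈-row⁻ p∈))) (proj₁ (∈-row⁻ p∈')))))

-- Entries of `X ^^ P` and of 0-1 indicators

toG-𝟏⁺ : ∀ {m n} (X : BMatrix m n) {i j} → X i j ≡ true → toG X i j ≡ 𝟏
toG-𝟏⁺ X eq rewrite eq = refl

module _ {m n : ℕ} (X : BMatrix m n) (P : PosSet m n) {i : Fin m} {j : Fin n} where

  ^^-𝟏⁺ : P i j ≢ true → toG X i j ≡ 𝟏 → (X ^^ P) i j ≡ 𝟏
  ^^-𝟏⁺ ¬p x with P i j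
  ... | true  = contradiction refl ¬p
  ... | false = x

  ^^-𝟏⁻ : (X ^^ P) i j ≡ 𝟏 → P i j ≢ true × toG X i j ≡ 𝟏
  ^^-𝟏⁻ x with P i j
  ... | false = (λ ()) , x

  ^^-𝟎⁺ : P ⊆supp X → toG X i j ≡ 𝟎 → (X ^^ P) i j ≡ 𝟎
  ^^-𝟎⁺ P⊆X z with P i j in eq
  ... | true  = contradiction z (𝟏≢𝟎 (toG-𝟏⁺ X (P⊆X i j eq)))
  ... | false = z

  ^^-𝟎⁻ : (X ^^ P) i j ≡ 𝟎 → toG X i j ≡ 𝟎
  ^^-𝟎⁻ z with P i j
  ... | false = z

indicator : ∀ {A : Set} → Dec A → Entry
indicator a? = if ⌊ a? ⌋ then 𝟏 else 𝟎

indicator-𝟏 : ∀ {A : Set} (a? : Dec A) → A → indicator a? ≡ 𝟏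
indicator-𝟏 (yes _) a = refl
indicator-𝟏 (no ¬a) a = contradiction a ¬a

indicator-𝟎 : ∀ {A : Set} (a? : Dec A) → ¬ A → indicator a? ≡ 𝟎
indicator-𝟎 (yes a) ¬a = contradiction a ¬a
indicator-𝟎 (no _)  ¬a = refl

indicator-𝟏⁻ : ∀ {A : Set} (a? : Dec A) → indicator a? ≡ 𝟏 → A
indicator-𝟏⁻ (yes a) _ = a

-- Old and new lines of an enlarged index set

module _ {k : ℕ} (t : ℕ) where

  liftSubset : Subset k → Subset (k + t)
  liftSubset A = ⟪ (λ r → any? λ i → (i ∈? A) ×-dec (r ≟ i ↑ˡ t)) ⟫

  restrictSubset : Subset (k + t) → Subset k
  restrictSubset A = ⟪ (λ i → (i ↑ˡ t) ∈? A) ⟫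

  ∈lift⁺ : ∀ {A i} → i ∈ A → (i ↑ˡ t) ∈ liftSubset A
  ∈lift⁺ {A} i∈ = ∈⟪⟫⁺ (λ r → any? λ i → (i ∈? A) ×-dec (r ≟ i ↑ˡ t)) (_ , i∈ , refl)

  ∈lift⁻ : ∀ {A r} → r ∈ liftSubset A → ∃ λ i → i ∈ A × r ≡ i ↑ˡ t
  ∈lift⁻ {A} = ∈⟪⟫⁻ (λ r → any? λ i → (i ∈? A) ×-dec (r ≟ i ↑ˡ t))

  ∈restrict⁺ : ∀ {A i} → (i ↑ˡ t) ∈ A → i ∈ restrictSubset A
  ∈restrict⁺ {A} = ∈⟪⟫⁺ (λ i → (i ↑ˡ t) ∈? A)

  ∈restrict⁻ : ∀ {A i} → i ∈ restrictSubset A → (i ↑ˡ t) ∈ A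
  ∈restrict⁻ {A} = ∈⟪⟫⁻ (λ i → (i ↑ˡ t) ∈? A)

-- Matching on the equation turns `r` into an old line `i ↑ˡ t` or a new line `m ↑ʳ s`, the forms in
-- which the entries are known.
line : ∀ m {t} (r : Fin (m + t)) → ∃ λ x → r ≡ join m t x
line m r = splitAt m r , sym (join-splitAt m _ r)

-- Entries of the stretched matrix

module _ {m n : ℕ} (X : BMatrix m n) (Q : PosSet m n) (Q⊆X : Q ⊆supp X) where

  private
    t : ℕ
    t = card Q

    S : GMatrix (m + t) (n + t)
    S = toG (stretch X Q)

    ℓ : Fin t → Fin m
    ℓ s = proj₁ (lookup (enum Q) s)

    κ : Fin t → Fin n
    κ s = proj₂ (lookup (enum Q) s)

    q∈Q : ∀ s → Q (ℓ s) (κ s) ≡ true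
    q∈Q s = ∈-enum⁻ Q (∈-lookup {xs = enum Q} s)

    listed : ∀ {i j} → Q i j ≡ true → ∃ λ s → i ≡ ℓ s × j ≡ κ s
    listed q = Any.index (∈-enum⁺ Q q) , cong proj₁ eq , cong proj₂ eq
      where eq = Any.lookup-index (∈-enum⁺ Q q)

    q-injective : ∀ {s s'} → ℓ s ≡ ℓ s' → κ s ≡ κ s' → s ≡ s'
    q-injective eq eq' = unique⇒lookup-injective (enum-unique Q) (cong₂ _,_ eq eq')

    S-old : ∀ i j → S (i ↑ˡ t) (j ↑ˡ t) ≡ toG X i j
    S-old i j rewrite splitAt-↑ˡ m i t | splitAt-↑ˡ n j t = refl

    S-right : ∀ i s → S (i ↑ˡ t) (n ↑ʳ s) ≡ indicator (i ≟ ℓ s)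
    S-right i s rewrite splitAt-↑ˡ m i t | splitAt-↑ʳ n t s = refl

    S-below : ∀ s j → S (m ↑ʳ s) (j ↑ˡ t) ≡ indicator (j ≟ κ s)
    S-below s j rewrite splitAt-↑ʳ m t s | splitAt-↑ˡ n j t = refl

    S-diag : ∀ s s' → S (m ↑ʳ s) (n ↑ʳ s') ≡ indicator (s ≟ s')
    S-diag s s' rewrite splitAt-↑ʳ m t s | splitAt-↑ʳ n t s' = refl

    module _ {s : Fin t} where

      right-𝟏⁺ : S (ℓ s ↑ˡ t) (n ↑ʳ s) ≡ 𝟏
      right-𝟏⁺ = trans (S-right _ s) (indicator-𝟏 (ℓ s ≟ ℓ s) refl)

      right-𝟏⁻ : ∀ {i} → S (i ↑ˡ t) (n ↑ʳ s) ≡ 𝟏 → i ≡ ℓ s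
      right-𝟏⁻ x = indicator-𝟏⁻ (_ ≟ ℓ s) (trans (sym (S-right _ s)) x)

      right-𝟎 : ∀ {i} → i ≢ ℓ s → S (i ↑ˡ t) (n ↑ʳ s) ≡ 𝟎
      right-𝟎 ≢ℓ = trans (S-right _ s) (indicator-𝟎 (_ ≟ ℓ s) ≢ℓ)

      below-𝟏⁺ : S (m ↑ʳ s) (κ s ↑ˡ t) ≡ 𝟏
      below-𝟏⁺ = trans (S-below s _) (indicator-𝟏 (κ s ≟ κ s) refl)

      below-𝟏⁻ : ∀ {j} → S (m ↑ʳ s) (j ↑ˡ t) ≡ 𝟏 → j ≡ κ s
      below-𝟏⁻ x = indicator-𝟏⁻ (_ ≟ κ s) (trans (sym (S-below s _)) x)

      below-𝟎 : ∀ {j} → j ≢ κ s → S (m ↑ʳ s) (j ↑ˡ t) ≡ 𝟎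
      below-𝟎 ≢κ = trans (S-below s _) (indicator-𝟎 (_ ≟ κ s) ≢κ)

      diag-𝟏⁺ : S (m ↑ʳ s) (n ↑ʳ s) ≡ 𝟏
      diag-𝟏⁺ = trans (S-diag s s) (indicator-𝟏 (s ≟ s) refl)

      diag-𝟏⁻ : ∀ {s'} → S (m ↑ʳ s) (n ↑ʳ s') ≡ 𝟏 → s ≡ s'
      diag-𝟏⁻ x = indicator-𝟏⁻ (s ≟ _) (trans (sym (S-diag s _)) x)

      diag-𝟎 : ∀ {s'} → s ≢ s' → S (m ↑ʳ s) (n ↑ʳ s') ≡ 𝟎
      diag-𝟎 s≢s' = trans (S-diag s _) (indicator-𝟎 (s ≟ _) s≢s')

    corner : Fin t → Fin (m + t) × Fin (n + t)
    corner s = m ↑ʳ s , n ↑ʳ s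

    lift : Fin m × Fin n → Fin (m + t) × Fin (n + t)
    lift (i , j) = i ↑ˡ t , j ↑ˡ t

    cornerBlock : Fin t → Rectangle (m + t) (n + t)
    cornerBlock s = block (lift (ℓ s , κ s)) (corner s)

    cornerBlock-zeroFree : ∀ s → ZeroFree S (cornerBlock s)
    cornerBlock-zeroFree s = block-zeroFree S
      (𝟏≢𝟎 (trans (S-old _ _) (toG-𝟏⁺ X (Q⊆X _ _ (q∈Q s)))))
      (𝟏≢𝟎 right-𝟏⁺) (𝟏≢𝟎 below-𝟏⁺) (𝟏≢𝟎 diag-𝟏⁺)

    corners-crossing : ∀ {s s'} → s ≢ s' → Crossing S (corner s) (corner s')
    corners-crossing s≢s' = inj₁ (diag-𝟎 s≢s')

    -- Among old columns, the new row `s` has its only 1 in `κ s`; among old rows, the new column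
    -- `s` has its only 1 in `ℓ s`. A position other than `q_s` misses one of the two.
    corner-crossing-lift : ∀ {s i j} → ¬ (i ≡ ℓ s × j ≡ κ s) → Crossing S (corner s) (lift (i , j))
    corner-crossing-lift {s} {i} {j} ≢q with i ≟ ℓ s | j ≟ κ s
    ... | no i≢  | _      = inj₂ (right-𝟎 i≢)
    ... | yes _  | no j≢  = inj₁ (below-𝟎 j≢)
    ... | yes i≡ | yes j≡ = contradiction (i≡ , j≡) ≢q

    data Position : Fin (m + t) × Fin (n + t) → Set where
      inner  : ∀ {i j} → toG X i j ≡ 𝟏 → Position (lift (i , j))
      right  : ∀ s → Position (ℓ s ↑ˡ t , n ↑ʳ s)
      below  : ∀ s → Position (m ↑ʳ s , κ s ↑ˡ t)
      diag   : ∀ s → Position (corner s)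

    position : ∀ r c → S r c ≡ 𝟏 → Position (r , c)
    position r c x with line m r | line n c
    ... | inj₁ i , refl | inj₁ j , refl = inner (trans (sym (S-old i j)) x)
    ... | inj₁ i , refl | inj₂ s , refl with refl ← right-𝟏⁻ x = right s
    ... | inj₂ s , refl | inj₁ j , refl with refl ← below-𝟏⁻ x = below s
    ... | inj₂ s , refl | inj₂ s' , refl with refl ← diag-𝟏⁻ x = diag s

    -- Non-firmness of the stretching

    restrict : Rectangle (m + t) (n + t) → Rectangle m n
    restrict (A , B) = restrictSubset t A , restrictSubset t B

    -- Old elements outside `Q` are kept. Every other element lies in some `cornerBlock s`; these
    -- blocks are zero-free, so distinct elements receive distinct `s`, and there are at most `t` of
    -- them.
    restrict-isolated : ∀ {F} → IsIsolated S ⊤ ⊤ F →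
                        ∃ λ F' → IsIsolated (X ^^ Q) ⊤ ⊤ F' × length F ≤ length F' + t
    restrict-isolated {F} (supp , cross) =
        F'
      , ( split-all (λ _ (_ , x) → ∈⊤ , ∈⊤ , x) sp supp
        , split-pairs (λ { c (refl , _) (refl , _) → Sum.map old-𝟎 old-𝟎 c }) sp cross)
      , (begin
          length F               ≡⟨ split-length sp ⟩
          length F' + length ss  ≤⟨ ℕ.+-monoʳ-≤ (length F') (unique⇒length≤ ss-unique) ⟩
          length F' + t          ∎)
      where
      open ℕ.≤-Reasoning

      Inner : Fin (m + t) × Fin (n + t) → Fin m × Fin n → Set
      Inner p q = p ≡ lift q × (X ^^ Q) (proj₁ q) (proj₂ q) ≡ 𝟏

      InBlock : Fin (m + t) × Fin (n + t) → Fin t → Set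
      InBlock p s = p ∈ᴿ cornerBlock s

      classify : ∀ {p} → Position p → ∃ (Inner p) ⊎ ∃ (InBlock p)
      classify (right s) = inj₂ (s , ∈⁅,⁆ˡ _ _ , ∈⁅,⁆ʳ _ _)
      classify (below s) = inj₂ (s , ∈⁅,⁆ʳ _ _ , ∈⁅,⁆ˡ _ _)
      classify (diag s)  = inj₂ (s , ∈⁅,⁆ʳ _ _ , ∈⁅,⁆ʳ _ _)
      classify (inner {i} {j} x) with Q i j Bool.≟ true
      ... | no ¬q = inj₁ ((i , j) , refl , ^^-𝟏⁺ X Q ¬q x)
      ... | yes q with s , refl , refl ← listed q = inj₂ (s , ∈⁅,⁆ˡ _ _ , ∈⁅,⁆ˡ _ _)

      classified : ∃₂ (Split Inner InBlock F)
      classified = split (All.map (λ (_ , _ , x) → classify (position _ _ x)) supp)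

      F' = proj₁ classified
      ss = proj₁ (proj₂ classified)
      sp = proj₂ (proj₂ classified)

      old-𝟎 : ∀ {i j} → S (i ↑ˡ t) (j ↑ˡ t) ≡ 𝟎 → (X ^^ Q) i j ≡ 𝟎
      old-𝟎 z = ^^-𝟎⁺ X Q Q⊆X (trans (sym (S-old _ _)) z)

      distinct : ∀ {p p' s s'} → Crossing S p p' → InBlock p s → InBlock p' s' → s ≢ s'
      distinct c p∈ p'∈ refl = crossing-separates S c (cornerBlock-zeroFree _) p∈ p'∈

      ss-unique : Unique ss
      ss-unique = split-pairs distinct (split-swap sp) cross

    -- The rectangles containing a corner are discarded. No rectangle contains two corners, so at
    -- least `t` are lost, and they meet the old block only in positions of `Q`, which `X ^^ Q` does
    -- not require to be covered.
    restrict-cover : ∀ {L} → IsCover S ⊤ ⊤ L →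
                     ∃ λ L' → IsCover (X ^^ Q) ⊤ ⊤ L' × length L' + t ≤ length L
    restrict-cover {L} (zf , cov) =
        L'
      , ( split-all restrict-zeroFree sp zf
        , covers')
      , (begin
          length L' + t          ≤⟨ ℕ.+-monoʳ-≤ (length L') (exhaustive⇒≤length corner-listed) ⟩
          length L' + length ss  ≡⟨ split-length sp ⟨
          length L               ∎)
      where
      open ℕ.≤-Reasoning

      Restriction : Rectangle (m + t) (n + t) → Rectangle m n → Set
      Restriction R R' = R' ≡ restrict R × (∀ s → ¬ corner s ∈ᴿ R)

      HasCorner : Rectangle (m + t) (n + t) → Fin t → Set
      HasCorner R s = corner s ∈ᴿ R

      classify : ∀ R → ∃ (Restriction R) ⊎ ∃ (HasCorner R)
      classify R@(A , B) with any? (λ s → ((m ↑ʳ s) ∈? A) ×-dec ((n ↑ʳ s) ∈? B))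
      ... | yes c = inj₂ c
      ... | no ¬c = inj₁ (restrict R , refl , λ s c → ¬c (s , c))

      classified : ∃₂ (Split Restriction HasCorner L)
      classified = split (All.universal classify L)

      L' = proj₁ classified
      ss = proj₁ (proj₂ classified)
      sp = proj₂ (proj₂ classified)

      restrict-zeroFree : ∀ {R R'} → ZeroFree S R → Restriction R R' → ZeroFree (X ^^ Q) R'
      restrict-zeroFree zf' (refl , _) a b a∈ b∈ z =
        zf' _ _ (∈restrict⁻ t a∈) (∈restrict⁻ t b∈) (trans (S-old a b) (^^-𝟎⁻ X Q z))

      covers' : ∀ p → InSupp (X ^^ Q) ⊤ ⊤ p → Any (p ∈ᴿ_) L'
      covers' p@(i , j) (_ , _ , x)
        with ¬q , x' ← ^^-𝟏⁻ X Q x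
        with R , R∈ , p∈ ← find (cov (lift p) (∈⊤ , ∈⊤ , trans (S-old i j) x'))
        with split-complete sp R∈
      ... | inj₁ any =
        Any.map (λ { (refl , _) → ∈restrict⁺ t (proj₁ p∈) , ∈restrict⁺ t (proj₂ p∈) }) any
      -- Had the rectangle through `lift p` been discarded for its corner `s`, `p` would be `q_s`,
      -- hence in `Q`.
      ... | inj₂ any with s , c∈ ← Any.satisfied any =
        contradiction p∈ (crossing-separates S
          (corner-crossing-lift λ { (refl , refl) → ¬q (q∈Q s) }) (All.lookup zf R∈) c∈)

      corner-listed : ∀ s → s ∈ᴸ ss
      corner-listed s
        with R , R∈ , s∈ ← find (cov (corner s) (∈⊤ , ∈⊤ , diag-𝟏⁺))
        with split-complete sp R∈
      ... | inj₁ any = contradiction s∈ (proj₂ (proj₂ (Any.satisfied any)) s)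
      -- The classification recorded some corner of `R`; as two corners cross, it can only be `s`.
      ... | inj₂ any = Any.map (λ {s'} s'∈ → decidable-stable (s ≟ s') λ s≢s' →
                         crossing-separates S (corners-crossing s≢s') (All.lookup zf R∈) s∈ s'∈) any

    stretch-ILtBr : ILtBr (X ^^ Q) ⊤ ⊤ → ILtBr S ⊤ ⊤
    stretch-ILtBr i<br a b (isoA , _) (covB , _) = decidable-stable (a ℕ.<? b) λ a≮b →
      ¬¬-IIs (X ^^ Q) ⊤ ⊤ λ (a' , i) → ¬¬-BrIs (X ^^ Q) ⊤ ⊤ λ (b' , br) →
      let F , iso , |F|≡a    = isolated⇒list S ⊤ ⊤ isoA
          L , cov , |L|≡b    = cover⇒list S ⊤ ⊤ covB
          F' , iso' , |F|≤   = restrict-isolated iso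
          L' , cov' , ≤|L|   = restrict-cover cov
      in a≮b (begin-strict
        a              ≡⟨ |F|≡a ⟨
        length F       ≤⟨ |F|≤ ⟩
        length F' + t  ≤⟨ ℕ.+-monoˡ-≤ t (proj₂ i _ (list⇒isolated (X ^^ Q) ⊤ ⊤ iso')) ⟩
        a' + t         <⟨ ℕ.+-monoˡ-< t (i<br a' b' i br) ⟩
        b' + t         ≤⟨ ℕ.+-monoˡ-≤ t (proj₂ br _ (list⇒cover (X ^^ Q) ⊤ ⊤ cov')) ⟩
        length L' + t  ≤⟨ ≤|L| ⟩
        length L       ≡⟨ |L|≡b ⟩
        b              ∎)
      where open ℕ.≤-Reasoning

    -- Proper submatrices of the stretching

    module Minor (I : Subset (m + t)) (J : Subset (n + t)) where

      Full RowOnly ColOnly : Fin t → Set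
      Full    s = (m ↑ʳ s) ∈ I × (n ↑ʳ s) ∈ J
      RowOnly s = (m ↑ʳ s) ∈ I × ¬ (n ↑ʳ s) ∈ J
      ColOnly s = ¬ (m ↑ʳ s) ∈ I × (n ↑ʳ s) ∈ J

      Full? : ∀ s → Dec (Full s)
      Full? s = ((m ↑ʳ s) ∈? I) ×-dec ((n ↑ʳ s) ∈? J)

      -- A new row kept without its new column has its only 1 in column κ s, so
      -- that whole column is one maximal rectangle and can be split off.
      DeadCol : Fin n → Set
      DeadCol j = (j ↑ˡ t) ∈ J × ∃ λ s → j ≡ κ s × RowOnly s

      DeadRow : Fin m → Set
      DeadRow i = (i ↑ˡ t) ∈ I × ∃ λ s → i ≡ ℓ s × ColOnly s

      DeadCol? : ∀ j → Dec (DeadCol j)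
      DeadCol? j = ((j ↑ˡ t) ∈? J) ×-dec
        any? λ s → (j ≟ κ s) ×-dec (((m ↑ʳ s) ∈? I) ×-dec ¬? ((n ↑ʳ s) ∈? J))

      DeadRow? : ∀ i → Dec (DeadRow i)
      DeadRow? i = ((i ↑ˡ t) ∈? I) ×-dec
        any? λ s → (i ≟ ℓ s) ×-dec (¬? ((m ↑ʳ s) ∈? I) ×-dec ((n ↑ʳ s) ∈? J))

      liveRow? : ∀ i → Dec ((i ↑ˡ t) ∈ I × ¬ DeadRow i)
      liveRow? i = ((i ↑ˡ t) ∈? I) ×-dec ¬? (DeadRow? i)

      liveCol? : ∀ j → Dec ((j ↑ˡ t) ∈ J × ¬ DeadCol j)
      liveCol? j = ((j ↑ˡ t) ∈? J) ×-dec ¬? (DeadCol? j)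

      I' : Subset m
      I' = ⟪ liveRow? ⟫

      J' : Subset n
      J' = ⟪ liveCol? ⟫

      FullAt : Fin m → Fin n → Set
      FullAt i j = ∃ λ s → (i ≡ ℓ s × j ≡ κ s) × Full s

      FullAt? : ∀ i j → Dec (FullAt i j)
      FullAt? i j = any? λ s → ((i ≟ ℓ s) ×-dec (j ≟ κ s)) ×-dec Full? s

      liftRect : Rectangle m n → Rectangle (m + t) (n + t)
      liftRect (A , B) = liftSubset t A , liftSubset t B

      -- The two conditions say that `P` consists of the `q_s` whose pair of new lines is kept. `P`
      -- stays a parameter so that `Q` itself can be used when all pairs are kept, without comparing
      -- sets that agree only pointwise.
      module _ (P : PosSet m n)
               (P⇒full : ∀ {i j} → P i j ≡ true → FullAt i j)
               (full⇒P : ∀ {s} → Full s → P (ℓ s) (κ s) ≡ true) where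

        P⊆X : P ⊆supp X
        P⊆X i j p with s , (refl , refl) , _ ← P⇒full p = Q⊆X i j (q∈Q s)

        fulls : List (∃ Full)
        fulls = collect Full?

        deadCols : List (∃ DeadCol)
        deadCols = collect DeadCol?

        deadRows : List (∃ DeadRow)
        deadRows = collect DeadRow?

        fullEntry : ∃ Full → Fin (m + t) × Fin (n + t)
        fullEntry (s , _) = corner s

        -- The only 1 that the new row `s` retains, since its new column has been deleted.
        colEntry : ∃ DeadCol → Fin (m + t) × Fin (n + t)
        colEntry (j , _ , s , _) = m ↑ʳ s , j ↑ˡ t

        rowEntry : ∃ DeadRow → Fin (m + t) × Fin (n + t)
        rowEntry (i , _ , s , _) = i ↑ˡ t , n ↑ʳ s

        extendIsolated : List (Fin m × Fin n) → List (Fin (m + t) × Fin (n + t))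
        extendIsolated F = map fullEntry fulls
                        ++ map colEntry deadCols
                        ++ map rowEntry deadRows
                        ++ map lift F

        -- Runs parallel to `extendIsolated`: block, column and row rectangles match corner, column
        -- and row entries one by one, so equal lengths are preserved.
        extendCover : List (Rectangle m n) → List (Rectangle (m + t) (n + t))
        extendCover L = map (cornerBlock ∘ proj₁) fulls
                     ++ map (colRect S ∘ (_↑ˡ t) ∘ proj₁) deadCols
                     ++ map (rowRect S ∘ (_↑ˡ t) ∘ proj₁) deadRows
                     ++ map liftRect L

        extend-length : ∀ F L → length F ≡ length L →
                        length (extendIsolated F) ≡ length (extendCover L)
        extend-length F L eq = ++-map fulls (++-map deadCols (++-map deadRows (begin
          length (map lift F)      ≡⟨ length-map lift F ⟩
          length F                 ≡⟨ eq ⟩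
          length L                 ≡⟨ length-map liftRect L ⟨
          length (map liftRect L)  ∎)))
          where
          open ≡-Reasoning
          ++-map : ∀ {A B C : Set} {f : A → B} {g : A → C} xs {ys zs} → length ys ≡ length zs →
                   length (map f xs ++ ys) ≡ length (map g xs ++ zs)
          ++-map []       eq = eq
          ++-map (x ∷ xs) eq = cong suc (++-map xs eq)

        -- Elements from `F` avoid dead lines, as `I'` and `J'` exclude them, and avoid each full
        -- `q_s`, where `X ^^ P` has a ?. Hence they cross all added entries; these cross one
        -- another through zeros of new lines.
        extend-isolated : ∀ {F} → IsIsolated (X ^^ P) I' J' F → IsIsolated S I J (extendIsolated F)
        extend-isolated {F} (supp , cross) =
            All.++⁺ (All.map⁺ (All.universal full-supp fulls))
              (All.++⁺ (All.map⁺ (All.universal col-supp deadCols))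
              (All.++⁺ (All.map⁺ (All.universal row-supp deadRows))
              (All.map⁺ (All.map lift-supp supp))))
          , AllPairs.++⁺ (AllPairs.map⁺ (AllPairs.map corners-crossing (collect-distinct Full?)))
              (AllPairs.++⁺ (AllPairs.map⁺ (AllPairs.map (λ {d d'} → col-col {d} {d'})
                (collect-distinct DeadCol?)))
              (AllPairs.++⁺ (AllPairs.map⁺ (AllPairs.map (λ {e e'} → row-row {e} {e'})
                (collect-distinct DeadRow?)))
              (AllPairs.map⁺ (AllPairs.map lift-lift cross))
              (All.map⁺ (All.universal (λ e → All.map⁺ (All.map (row-lift e) supp)) deadRows)))
              (All.map⁺ (All.universal (λ d → All.++⁺
                (All.map⁺ (All.universal (col-row d) deadRows))
                (All.map⁺ (All.map (col-lift d) supp))) deadCols)))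
              (All.map⁺ (All.universal (λ f → All.++⁺
                (All.map⁺ (All.universal (full-col f) deadCols)) (All.++⁺
                (All.map⁺ (All.universal (full-row f) deadRows))
                (All.map⁺ (All.map (full-lift f) supp)))) fulls))
          where
          full-supp : ∀ f → InSupp S I J (fullEntry f)
          full-supp (s , r∈ , c∈) = r∈ , c∈ , diag-𝟏⁺

          col-supp : ∀ d → InSupp S I J (colEntry d)
          col-supp (_ , j∈ , s , refl , s∈ , _) = s∈ , j∈ , below-𝟏⁺

          row-supp : ∀ e → InSupp S I J (rowEntry e)
          row-supp (_ , i∈ , s , refl , _ , s∈) = i∈ , s∈ , right-𝟏⁺

          lift-supp : ∀ {p} → InSupp (X ^^ P) I' J' p → InSupp S I J (lift p)
          lift-supp (i∈ , j∈ , x) =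
            proj₁ (∈⟪⟫⁻ liveRow? i∈) , proj₁ (∈⟪⟫⁻ liveCol? j∈) ,
            trans (S-old _ _) (proj₂ (^^-𝟏⁻ X P x))

          full-col : ∀ f d → Crossing S (fullEntry f) (colEntry d)
          -- The two indices differ because one new column is kept in `J` and the other is not.
          full-col (_ , _ , c∈) (_ , _ , _ , _ , _ , c∉) = inj₂ (diag-𝟎 λ { refl → c∉ c∈ })

          full-row : ∀ f e → Crossing S (fullEntry f) (rowEntry e)
          full-row (_ , r∈ , _) (_ , _ , _ , _ , r∉ , _) = inj₁ (diag-𝟎 λ { refl → r∉ r∈ })

          full-lift : ∀ f {p} → InSupp (X ^^ P) I' J' p → Crossing S (fullEntry f) (lift p)
          full-lift (_ , full) (_ , _ , x) =
            corner-crossing-lift λ { (refl , refl) → proj₁ (^^-𝟏⁻ X P x) (full⇒P full) }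

          col-col : ∀ {d d'} → proj₁ d ≢ proj₁ d' → Crossing S (colEntry d) (colEntry d')
          col-col {_ , _ , _ , refl , _} d≢d' = inj₁ (below-𝟎 (≢-sym d≢d'))

          row-row : ∀ {e e'} → proj₁ e ≢ proj₁ e' → Crossing S (rowEntry e) (rowEntry e')
          row-row {_ , _ , _ , refl , _} e≢e' = inj₂ (right-𝟎 (≢-sym e≢e'))

          col-row : ∀ d e → Crossing S (colEntry d) (rowEntry e)
          col-row (_ , _ , _ , _ , r∈ , _) (_ , _ , _ , _ , r∉ , _) =
            inj₁ (diag-𝟎 λ { refl → r∉ r∈ })

          col-lift : ∀ d {p} → InSupp (X ^^ P) I' J' p → Crossing S (colEntry d) (lift p)
          col-lift (_ , dead@(_ , _ , refl , _)) (_ , j∈ , _) =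
            inj₁ (below-𝟎 λ { refl → proj₂ (∈⟪⟫⁻ liveCol? j∈) dead })

          row-lift : ∀ e {p} → InSupp (X ^^ P) I' J' p → Crossing S (rowEntry e) (lift p)
          row-lift (_ , dead@(_ , _ , refl , _)) (i∈ , _ , _) =
            inj₂ (right-𝟎 λ { refl → proj₂ (∈⟪⟫⁻ liveRow? i∈) dead })

          lift-lift : ∀ {p q} → Crossing (X ^^ P) p q → Crossing S (lift p) (lift q)
          lift-lift = Sum.map old-𝟎 old-𝟎
            where
            old-𝟎 : ∀ {i j} → (X ^^ P) i j ≡ 𝟎 → S (i ↑ˡ t) (j ↑ˡ t) ≡ 𝟎
            old-𝟎 z = trans (S-old _ _) (^^-𝟎⁻ X P z)

        -- A 1 on a dead line is covered by the rectangle of that line, a 1 in the block of a full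
        -- pair by that block. Any other 1 is old, lies in `I'` × `J'` outside `P`, and is left to
        -- `L`.
        extend-cover : ∀ {L} → IsCover (X ^^ P) I' J' L → IsCover S I J (extendCover L)
        extend-cover {L} (zf , cov) =
            All.++⁺ (All.map⁺ (All.universal (cornerBlock-zeroFree ∘ proj₁) fulls))
              (All.++⁺ (All.map⁺ (All.universal (colRect-zeroFree S ∘ (_↑ˡ t) ∘ proj₁) deadCols))
              (All.++⁺ (All.map⁺ (All.universal (rowRect-zeroFree S ∘ (_↑ˡ t) ∘ proj₁) deadRows))
              (All.map⁺ (All.map lift-zeroFree zf))))
          , λ p p∈ → covered p p∈ (position _ _ (proj₂ (proj₂ p∈)))
          where
          lift-zeroFree : ∀ {R} → ZeroFree (X ^^ P) R → ZeroFree S (liftRect R)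
          lift-zeroFree zf' a b a∈ b∈ z
            with i , i∈ , refl ← ∈lift⁻ t a∈ | j , j∈ , refl ← ∈lift⁻ t b∈ =
            zf' i j i∈ j∈ (^^-𝟎⁺ X P P⊆X (trans (sym (S-old i j)) z))

          in-block : ∀ {p s} → Full s → p ∈ᴿ cornerBlock s → Any (p ∈ᴿ_) (extendCover L)
          in-block full p∈ =
            Any.++⁺ˡ (Any.map⁺ (Any.map (λ { refl → p∈ }) (collect-complete Full? full)))

          in-col : ∀ {r j} → DeadCol j → S r (j ↑ˡ t) ≡ 𝟏 → Any ((r , j ↑ˡ t) ∈ᴿ_) (extendCover L)
          in-col dead x = Any.++⁺ʳ (map _ fulls) (Any.++⁺ˡ (Any.map⁺
            (Any.map (λ { refl → ∈colRect S x }) (collect-complete DeadCol? dead))))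

          in-row : ∀ {i c} → DeadRow i → S (i ↑ˡ t) c ≡ 𝟏 → Any ((i ↑ˡ t , c) ∈ᴿ_) (extendCover L)
          in-row dead x = Any.++⁺ʳ (map _ fulls) (Any.++⁺ʳ (map _ deadCols) (Any.++⁺ˡ (Any.map⁺
            (Any.map (λ { refl → ∈rowRect S x }) (collect-complete DeadRow? dead)))))

          in-lift : ∀ {p} → InSupp (X ^^ P) I' J' p → Any (lift p ∈ᴿ_) (extendCover L)
          in-lift p∈ = Any.++⁺ʳ (map _ fulls) (Any.++⁺ʳ (map _ deadCols)
            (Any.++⁺ʳ (map _ deadRows) (Any.map⁺
            (Any.map (λ (i∈ , j∈) → ∈lift⁺ t i∈ , ∈lift⁺ t j∈) (cov _ p∈)))))

          covered : ∀ p → InSupp S I J p → Position p → Any (p ∈ᴿ_) (extendCover L)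
          covered _ (i∈ , j∈ , x) (inner {i} {j} x')
            with DeadCol? j | DeadRow? i | P i j Bool.≟ true
          ... | yes dead | _        | _      = in-col dead x
          ... | no _     | yes dead | _      = in-row dead x
          ... | no c     | no r     | no ¬p  =
            in-lift (∈⟪⟫⁺ liveRow? (i∈ , r) , ∈⟪⟫⁺ liveCol? (j∈ , c) , ^^-𝟏⁺ X P ¬p x')
          ... | no _     | no _     | yes p with s , (refl , refl) , full ← P⇒full p =
            in-block full (∈⁅,⁆ˡ _ _ , ∈⁅,⁆ˡ _ _)
          covered _ (i∈ , s∈ , x) (right s) with (m ↑ʳ s) ∈? I
          ... | yes s∈I = in-block (s∈I , s∈) (∈⁅,⁆ˡ _ _ , ∈⁅,⁆ʳ _ _)
          -- The new column is kept without its new row, which makes the old row `ℓ s` dead.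
          ... | no  s∉I = in-row (i∈ , s , refl , s∉I , s∈) x
          covered _ (s∈ , j∈ , x) (below s) with (n ↑ʳ s) ∈? J
          ... | yes s∈J = in-block (s∈ , s∈J) (∈⁅,⁆ʳ _ _ , ∈⁅,⁆ˡ _ _)
          ... | no  s∉J = in-col (j∈ , s , refl , s∈ , s∉J) x
          covered _ (r∈ , c∈ , _) (diag s) = in-block (r∈ , c∈) (∈⁅,⁆ʳ _ _ , ∈⁅,⁆ʳ _ _)

        extend-IEqBr : IEqBr (X ^^ P) I' J' → IEqBr S I J
        extend-IEqBr i≡br a b i br = decidable-stable (a ℕ.≟ b) λ a≢b →
          IEqBr⇒¬¬Tight (X ^^ P) I' J' i≡br λ (F , L , iso , cov , eq) →
          a≢b (tight⇒IEqBr S I J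
            (_ , _ , extend-isolated iso , extend-cover cov , extend-length F L eq) a b i br)

      -- The choice of `P` for a given submatrix

      fullSet : PosSet m n
      fullSet i j = does (FullAt? i j)

      fullSet⇒ : ∀ {i j} → fullSet i j ≡ true → FullAt i j
      fullSet⇒ {i} {j} = does-true (FullAt? i j)

      fullSet-⊊ : ¬ (∀ s → Full s) → fullSet ⊊P Q
      fullSet-⊊ ¬full with s , ¬s ← ¬∀⟶∃¬ t Full Full? ¬full =
          (λ i j p → case fullSet⇒ p of λ { (s , (refl , refl) , _) → q∈Q s })
        , ℓ s , κ s , q∈Q s
        -- Distinct indices enumerate distinct positions, so no other full pair can put `q_s` into
        -- `fullSet`.
        , dec-false (FullAt? (ℓ s) (κ s)) λ (s' , (eq , eq') , full) →
            ¬s (subst Full (sym (q-injective eq eq')) full)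

      -- All new lines are kept, so a deleted line is an old one, and it is missing from `I'` or
      -- `J'` as well.
      proper : (∀ s → Full s) → ¬ (I ≡ ⊤ × J ≡ ⊤) → ¬ (I' ≡ ⊤ × J' ≡ ⊤)
      proper full ¬⊤ (I'≡⊤ , J'≡⊤) = ¬⊤
        ( ⊆-antisym ⊆⊤ (λ {r} _ → allRows r (line m r))
        , ⊆-antisym ⊆⊤ (λ {c} _ → allCols c (line n c)))
        where
        allRows : ∀ r → ∃ (λ x → r ≡ join m t x) → r ∈ I
        allRows _ (inj₁ i , refl) = proj₁ (∈⟪⟫⁻ liveRow? (subst (i ∈_) (sym I'≡⊤) ∈⊤))
        allRows _ (inj₂ s , refl) = proj₁ (full s)
        allCols : ∀ c → ∃ (λ y → c ≡ join n t y) → c ∈ J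
        allCols _ (inj₁ j , refl) = proj₁ (∈⟪⟫⁻ liveCol? (subst (j ∈_) (sym J'≡⊤) ∈⊤))
        allCols _ (inj₂ s , refl) = proj₂ (full s)

      minor-IEqBr : (∀ I J → ¬ (I ≡ ⊤ × J ≡ ⊤) → IEqBr (X ^^ Q) I J) →
                    (∀ P → P ⊊P Q → Firm (X ^^ P)) →
                    ¬ (I ≡ ⊤ × J ≡ ⊤) → IEqBr S I J
      minor-IEqBr minimal firm ¬⊤ with all? Full?
      ... | no ¬full = extend-IEqBr fullSet fullSet⇒
                         (λ full → dec-true (FullAt? _ _) (_ , (refl , refl) , full))
                         (firm fullSet (fullSet-⊊ ¬full) I' J')
      ... | yes full = extend-IEqBr Q (λ q → map₂ (λ eqs → eqs , full _) (listed q)) (λ _ → q∈Q _)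
                         (minimal I' J' (proper full ¬⊤))

  stretch-minimallyNonFirm : MinimallyNonFirm (X ^^ Q) → (∀ P → P ⊊P Q → Firm (X ^^ P)) →
                             MinimallyNonFirm (toG (stretch X Q))
  stretch-minimallyNonFirm (i<br , minimal) firm =
    stretch-ILtBr i<br , λ I J → Minor.minor-IEqBr I J minimal firm

theorem3 : ∀ {m n : ℕ} (X : BMatrix m n) (Q : PosSet m n) →
    Q ⊆supp X → NonEmptyP Q →
    MinimallyNonFirm (X ^^ Q) →
    (∀ (P : PosSet m n) → P ⊊P Q → Firm (X ^^ P)) →
    MinimallyNonFirm (toG (stretch X Q))
theorem3 X Q Q⊆X _ = stretch-minimallyNonFirm X Q Q⊆X
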